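{- Let $n\ge 2$ be an integer and $m=\min\{k\in\mathbb{N}: n\le\tfrac12(k^3-k^2)\}$. Then $\chi_{L_2}(P_n)=m$. Moreover, for the path $P_n=v_1v_2\cdots v_n$ there exists a neighbor locating coloring $f_n:V(P_n)\to[m]$ (onto) such that $f_n(v_{n-1})=2$ and $f_n(v_n)=1$; furthermore, if $n\ge 9$ then also $f_n(v_{n-2})=m$, and if $n\ge 9$ and $n\ne\tfrac12(m^3-m^2)-1$ then also $f_n(v_1)=2$ and $f_n(v_2)=1$.
   Context: All graphs are finite and simple; $P_n=v_1v_2\cdots v_n$ is the path with edges $v_iv_{i+1}$, $1\le i<n$. A proper $k$-coloring of $G$ is a map $f$ from $V(G)$ onto $[k]=\{1,\dots,k\}$ with adjacent vertices receiving different colors; $f(S)=\{f(u):u\in S\}$ and $N_G(u)$ is the neighborhood of $u$. A proper $k$-coloring $f$ is a neighbor locating coloring if for any two distinct vertices $u,v$ with $f(u)=f(v)$ we have $f(N_G(u))\ne f(N_G(v))$; $\chi_{L_2}(G)$ is the minimum number of colors in a neighbor locating coloring of $G$. -}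

module Defs where

open import Data.Fin using (Fin; toℕ)
open import Data.Nat using (ℕ; suc; _≤_; _∸_; _^_; _≟_)
open import Data.Nat.DivMod using (_/_)
open import Data.Nat.Properties using (1+n≢n)
open import Data.Product using (_×_; ∃-syntax)
open import Data.Sum using (_⊎_; inj₁; inj₂; swap)
open import Function.Definitions using (Surjective)
open import Level using (0ℓ)
open import Relation.Binary.Core using (Rel)
open import Relation.Binary.Definitions using (Decidable; Irreflexive; Symmetric)
open import Relation.Binary.PropositionalEquality using (_≡_; _≢_; refl; sym)
open import Relation.Nullary using (¬_)
open import Relation.Nullary.Decidable using (_⊎-dec_)
open import Relation.Unary using (Pred; _∈_; _≐_)

IsLeast : Pred ℕ 0ℓ → Pred ℕ 0ℓ
IsLeast P k = k ∈ P × (∀ j → j ∈ P → k ≤ j)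

record Graph : Set₁ where
  field
    order      : ℕ
    Adj        : Rel (Fin order) 0ℓ
    adj?       : Decidable Adj
    adj-sym    : Symmetric Adj
    adj-irrefl : Irreflexive _≡_ Adj

  Vertex : Set
  Vertex = Fin order

  N : Vertex → Pred Vertex 0ℓ
  N u v = Adj u v

open Graph public using (Vertex; Adj; N)

-- An element of Fin k stands for an element of [k] = {1, …, k}; its number
-- there is one more than its index.  This applies to colours and to the
-- vertices v₁, …, vₙ of the path.
number : ∀ {k} → Fin k → ℕ
number i = suc (toℕ i)

image : ∀ {A B : Set} → (A → B) → Pred A 0ℓ → Pred B 0ℓ
image f S c = ∃[ u ] (u ∈ S × f u ≡ c)

record IsProperColoring (G : Graph) (k : ℕ) (f : Vertex G → Fin k) : Set where
  field
    onto   : Surjective _≡_ _≡_ f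
    proper : ∀ u v → Adj G u v → f u ≢ f v

record IsNeighborLocating (G : Graph) (k : ℕ) (f : Vertex G → Fin k) : Set where
  field
    isProperColoring : IsProperColoring G k f
    locating         : ∀ u v → u ≢ v → f u ≡ f v →
                       ¬ (image f (N G u) ≐ image f (N G v))

χL₂[_]≡_ : Graph → ℕ → Set
χL₂[ G ]≡ m =
  IsLeast (λ k → ∃[ f ] IsNeighborLocating G k f) m

path : ℕ → Graph
path n = record
  { order      = n
  ; Adj        = λ u v → number v ≡ suc (number u) ⊎ number u ≡ suc (number v)
  ; adj?       = λ u v → (number v ≟ suc (number u)) ⊎-dec (number u ≟ suc (number v))
  ; adj-sym    = swap
  ; adj-irrefl = λ { refl (inj₁ e) → 1+n≢n (sym e)
                   ; refl (inj₂ e) → 1+n≢n (sym e) }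
  }

-- ½(k³ − k²).  Both operations are exact: k² ≤ k³ for every natural k, and
-- k³ − k² is even.
bound : ℕ → ℕ
bound k = (k ^ 3 ∸ k ^ 2) / 2

-- f [v i ]≡ c says that vᵢ exists and that f(vᵢ) = c, with i and c numbered
-- from 1.
_[v_]≡_ : ∀ {n k} → (Fin n → Fin k) → ℕ → ℕ → Set
f [v i ]≡ c = ∃[ u ] (number u ≡ i × number (f u) ≡ c)

-- Record each vertex of a coloured path as a window (left, centre, right) of the
-- colour word, the missing neighbour of an end being replaced by the other one.
-- The colouring is neighbour locating iff all windows differ up to reversal, and
-- ½(k³ − k²) proper windows on k colours exist up to reversal: this bounds n.
--
-- For the converse, a word ending in 2 1 is prolonged by a new colour m along a
-- closed walk that returns to 2 1 and all of whose windows contain m: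
--   m · star k ⋯ star 3 · 1 m · 2 m 2 1,  star c = c · ((c−1) m c) ⋯ (2 m c) · (m c) · 1 m,
-- with k = m − 1.  It meets every window containing m exactly once.  The spokes
-- (a m c) and the loops (m c), 1 m, m 2 can be dropped without creating new
-- windows, so the length can be lowered in steps of 3 and 2.  The few lengths
-- missed this way are obtained by shortening the previous word as well, and
-- ½(m³ − m²) − 1 by starting from 3 2 3 1 3 1 2 1 instead of 2 1.
-- Colours are numbered from 0 in the words below.
module Submission where

open import Defs
open import Data.Bool using (Bool; true; false)
open import Data.Fin as Fin using (Fin; zero; suc; toℕ; fromℕ<; inject₁; combine; remQuot; punchOut)
open import Data.Fin.Properties using (toℕ-injective; toℕ-fromℕ<; toℕ<n; toℕ-inject₁; combine-injective; combine-remQuot; punchOut-injective; injective⇒≤)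
open import Data.List using (List; []; _∷_; _++_; length; lookup)
open import Data.List.Membership.Propositional using (_∈_)
open import Data.List.Membership.Propositional.Properties using (∈-++⁺ˡ; ∈-++⁺ʳ)
open import Data.List.Properties using (++-assoc; length-++)
open import Data.List.Relation.Unary.All as All using (All; []; _∷_)
open import Data.List.Relation.Unary.All.Properties using (++⁺)
open import Data.List.Relation.Unary.AllPairs as AllPairs using (AllPairs; []; _∷_; allPairs?)
import Data.List.Relation.Unary.AllPairs.Properties as AllPairs
open import Data.List.Relation.Unary.Any as Any using (here; there)
open import Data.Nat
open import Data.List.Membership.DecPropositional _≟_ using (_∈?_)
open import Data.Nat.DivMod using (_/_; m*n/n≡m; /-monoˡ-≤)
open import Data.Nat.Properties
open import Data.Nat.Tactic.RingSolver using (solve-∀)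
open import Data.Product using (_×_; _,_; proj₁; proj₂; ∃-syntax)
open import Data.Sum using (_⊎_; inj₁; inj₂; [_,_]′)
open import Function using (_∘_)
open import Function.Definitions using (Surjective)
open import Relation.Binary.Definitions using (tri<; tri≈; tri>)
open import Relation.Binary.PropositionalEquality
open import Relation.Nullary using (¬_; Dec; yes; no; contradiction)
open import Relation.Nullary.Decidable using (¬?; _×-dec_; True; map′; toWitness)
open import Relation.Unary using (_≐_)

-- Windows up to reversal.

record Window : Set where
  constructor win
  field
    left centre right : ℕ

data _~_ : Window → Window → Set where
  same : ∀ {w} → w ~ w
  flip : ∀ {a b c} → win a b c ~ win c b a

_≁_ : Window → Window → Set
v ≁ w = ¬ (v ~ w)

~-sym : ∀ {v w} → v ~ w → w ~ v
~-sym same = same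
~-sym flip = flip

≁-sym : ∀ {v w} → v ≁ w → w ≁ v
≁-sym v≁w = v≁w ∘ ~-sym

data _∈ʷ_ : ℕ → Window → Set where
  left   : ∀ {a b c} → a ∈ʷ win a b c
  centre : ∀ {a b c} → b ∈ʷ win a b c
  right  : ∀ {a b c} → c ∈ʷ win a b c

data Each (P : ℕ → Set) : Window → Set where
  each : ∀ {a b c} → P a → P b → P c → Each P (win a b c)

Proper : Window → Set
Proper (win a b c) = a ≢ b × b ≢ c

Each-map : ∀ {P Q : ℕ → Set} → (∀ {x} → P x → Q x) → ∀ {w} → Each P w → Each Q w
Each-map f (each a b c) = each (f a) (f b) (f c)

Each-lookup : ∀ {P : ℕ → Set} {x v w} → Each P w → x ∈ʷ v → v ~ w → P x
Each-lookup (each a b c) left   same = a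
Each-lookup (each a b c) centre same = b
Each-lookup (each a b c) right  same = c
Each-lookup (each a b c) left   flip = c
Each-lookup (each a b c) centre flip = b
Each-lookup (each a b c) right  flip = a

-- Reversal keeps the letters of a window, so a letter present throughout `vs` and banned from `ws`
-- separates the two lists. Distinctness of concatenated blocks mostly rests on such a letter.
cross : ∀ {P : ℕ → Set} {x vs ws} → ¬ P x → All (x ∈ʷ_) vs → All (Each P) ws →
        All (λ v → All (v ≁_) ws) vs
cross ¬Px x∈vs Pws =
  All.map (λ x∈v → All.map (λ Pw v~w → ¬Px (Each-lookup Pw x∈v v~w)) Pws) x∈vs

cross′ : ∀ {P : ℕ → Set} {x vs ws} → ¬ P x → All (Each P) vs → All (x ∈ʷ_) ws →
         All (λ v → All (v ≁_) ws) vs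
cross′ ¬Px Pvs x∈ws =
  All.map (λ Pv → All.map (λ x∈w v~w → ¬Px (Each-lookup Pv x∈w (~-sym v~w))) x∈ws) Pvs

centre≢⇒≁ : ∀ {a b c a′ b′ c′} → b ≢ b′ → win a b c ≁ win a′ b′ c′
centre≢⇒≁ b≢b′ same = b≢b′ refl
centre≢⇒≁ b≢b′ flip = b≢b′ refl

-- Walks and stars.

-- Walk x y s x′ y′ ws: reading s after the letters x y ends with the letters x′ y′,
-- and ws are the windows passed, from the one centred at y to the one before y′.
data Walk : ℕ → ℕ → List ℕ → ℕ → ℕ → List Window → Set where
  stop : ∀ {x y} → Walk x y [] x y []
  step : ∀ {x y z s x′ y′ ws} → Walk y z s x′ y′ ws → Walk x y (z ∷ s) x′ y′ (win x y z ∷ ws)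

_++ʷ_ : ∀ {x y s x′ y′ ws s′ x″ y″ ws′} → Walk x y s x′ y′ ws → Walk x′ y′ s′ x″ y″ ws′ →
        Walk x y (s ++ s′) x″ y″ (ws ++ ws′)
stop   ++ʷ q = q
step p ++ʷ q = step (p ++ʷ q)

-- The alphabet of a tail: the hub `m` and the old letters below the next tip `c`.
Below : ℕ → ℕ → ℕ → Set
Below m c e = e ≡ m ⊎ e < c

loopSize : Bool → ℕ
loopSize true  = 2
loopSize false = 0

module Star (m c : ℕ) where

  loop : Bool → List ℕ
  loop true  = m ∷ c ∷ []
  loop false = []

  loopWindows : Bool → List Window
  loopWindows true  = win m c m ∷ win c m c ∷ []
  loopWindows false = []

  -- A spoke is a triangle `c a m c`, meeting the three windows on the letters `a`, `c`, `m`, one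
  -- for each centre. The loop `c m c` meets the two windows alternating `m` and `c`. Both return to
  -- the position `m c`, so leaving one out creates no new window.
  spokes : Bool → ℕ → List ℕ
  spokes ℓ zero    = loop ℓ
  spokes ℓ (suc t) = suc t ∷ m ∷ c ∷ spokes ℓ t

  spokeWindows : Bool → ℕ → List Window
  spokeWindows ℓ zero    = loopWindows ℓ
  spokeWindows ℓ (suc t) =
    win m c (suc t) ∷ win c (suc t) m ∷ win (suc t) m c ∷ spokeWindows ℓ t

  spokes-length : ∀ ℓ t → length (spokes ℓ t) ≡ loopSize ℓ + 3 * t
  spokes-length true  zero    = refl
  spokes-length false zero    = refl
  spokes-length ℓ     (suc t) = trans (cong (3 +_) (spokes-length ℓ t)) (lemma (loopSize ℓ) t)
    where
    lemma : ∀ l t → 3 + (l + 3 * t) ≡ l + 3 * suc t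
    lemma = solve-∀

  spokes-walk : ∀ ℓ t → Walk m c (spokes ℓ t) m c (spokeWindows ℓ t)
  spokes-walk true  zero    = step (step stop)
  spokes-walk false zero    = stop
  spokes-walk ℓ     (suc t) = step (step (step (spokes-walk ℓ t)))

  -- The triangle at foot 0 is split: `win 0 m c` is met on entering the star, its other two windows
  -- on leaving. This closes the walk at `0 m`. The star is complete when `ℓ` is `true` and `t` is c
  -- - 1.
  star : Bool → ℕ → List ℕ
  star ℓ t = c ∷ spokes ℓ t ++ 0 ∷ m ∷ []

  starWindows : Bool → ℕ → List Window
  starWindows ℓ t = win 0 m c ∷ spokeWindows ℓ t ++ win m c 0 ∷ win c 0 m ∷ []

  star-walk : ∀ ℓ t → Walk 0 m (star ℓ t) 0 m (starWindows ℓ t)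
  star-walk ℓ t = step (spokes-walk ℓ t ++ʷ step (step stop))

  star-length : ∀ ℓ t → length (star ℓ t) ≡ loopSize ℓ + 3 * suc t
  star-length ℓ t = begin
    suc (length (spokes ℓ t ++ 0 ∷ m ∷ [])) ≡⟨ cong suc (length-++ (spokes ℓ t)) ⟩
    suc (length (spokes ℓ t) + 2)           ≡⟨ cong (λ x → suc (x + 2)) (spokes-length ℓ t) ⟩
    suc (loopSize ℓ + 3 * t + 2)            ≡⟨ lemma (loopSize ℓ) t ⟩
    loopSize ℓ + 3 * suc t                  ∎
    where
    open ≡-Reasoning
    lemma : ∀ l t → suc (l + 3 * t + 2) ≡ l + 3 * suc t
    lemma = solve-∀

  record InStar (w : Window) : Set where
    constructor inStar
    field
      hub    : m ∈ʷ w
      tip    : c ∈ʷ w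
      proper : Proper w
      within : Each (Below m (suc c)) w

  module _ (0<c : 0 < c) (c<m : c < m) where

    private
      0≢c : 0 ≢ c
      0≢c = <⇒≢ 0<c

      0≢m : 0 ≢ m
      0≢m = <⇒≢ (<-trans 0<c c<m)

      c≢m : c ≢ m
      c≢m = <⇒≢ c<m

    inHub : ∀ {a} → a < c → InStar (win a m c)
    inHub a<c = inStar centre right (<⇒≢ (<-trans a<c c<m) , c≢m ∘ sym)
                  (each (inj₂ (m<n⇒m<1+n a<c)) (inj₁ refl) (inj₂ ≤-refl))

    inTip : ∀ {a} → a < c → InStar (win m c a)
    inTip a<c = inStar left centre (c≢m ∘ sym , <⇒≢ a<c ∘ sym)
                  (each (inj₁ refl) (inj₂ ≤-refl) (inj₂ (m<n⇒m<1+n a<c)))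

    inFoot : ∀ {a} → a < c → InStar (win c a m)
    inFoot a<c = inStar right left (<⇒≢ a<c ∘ sym , <⇒≢ (<-trans a<c c<m))
                  (each (inj₂ ≤-refl) (inj₂ (m<n⇒m<1+n a<c)) (inj₁ refl))

    spokes-inStar : ∀ ℓ {t} → t < c → All InStar (spokeWindows ℓ t)
    spokes-inStar true  {zero}  _   =
      inStar left centre (c≢m ∘ sym , c≢m) (each (inj₁ refl) (inj₂ ≤-refl) (inj₁ refl)) ∷
      inStar centre left (c≢m , c≢m ∘ sym) (each (inj₂ ≤-refl) (inj₁ refl) (inj₂ ≤-refl)) ∷ []
    spokes-inStar false {zero}  _   = []
    spokes-inStar ℓ     {suc t} t<c =
      inTip t<c ∷ inFoot t<c ∷ inHub t<c ∷ spokes-inStar ℓ (<-trans (n<1+n t) t<c)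

    star-inStar : ∀ ℓ {t} → t < c → All InStar (starWindows ℓ t)
    star-inStar ℓ t<c = inHub 0<c ∷ ++⁺ (spokes-inStar ℓ t<c) (inTip 0<c ∷ inFoot 0<c ∷ [])

    OnSpokes : ℕ → ℕ → Set
    OnSpokes t e = e ≡ m ⊎ e ≡ c ⊎ (0 < e × e ≤ t)

    OnSpokes-suc : ∀ {t e} → OnSpokes t e → OnSpokes (suc t) e
    OnSpokes-suc (inj₁ e)                 = inj₁ e
    OnSpokes-suc (inj₂ (inj₁ e))          = inj₂ (inj₁ e)
    OnSpokes-suc (inj₂ (inj₂ (0<e , e≤))) = inj₂ (inj₂ (0<e , m≤n⇒m≤1+n e≤))

    0-notOnSpokes : ∀ {t} → ¬ OnSpokes t 0
    0-notOnSpokes (inj₁ e)               = 0≢m e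
    0-notOnSpokes (inj₂ (inj₁ e))        = 0≢c e
    0-notOnSpokes (inj₂ (inj₂ (() , _)))

    suc-notOnSpokes : ∀ {t} → suc t < c → ¬ OnSpokes t (suc t)
    suc-notOnSpokes t<c (inj₁ e)              = <⇒≢ (<-trans t<c c<m) e
    suc-notOnSpokes t<c (inj₂ (inj₁ e))       = <⇒≢ t<c e
    suc-notOnSpokes t<c (inj₂ (inj₂ (_ , e))) = 1+n≰n e

    spokes-on : ∀ ℓ t → All (Each (OnSpokes t)) (spokeWindows ℓ t)
    spokes-on true  zero    =
      each (inj₁ refl) (inj₂ (inj₁ refl)) (inj₁ refl) ∷
      each (inj₂ (inj₁ refl)) (inj₁ refl) (inj₂ (inj₁ refl)) ∷ []
    spokes-on false zero    = []
    spokes-on ℓ     (suc t) =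
      each hub tip foot ∷ each tip foot hub ∷ each foot hub tip ∷
      All.map (Each-map (λ {e} → OnSpokes-suc {t} {e})) (spokes-on ℓ t)
      where
      hub : OnSpokes (suc t) m
      hub = inj₁ refl
      tip : OnSpokes (suc t) c
      tip = inj₂ (inj₁ refl)
      foot : OnSpokes (suc t) (suc t)
      foot = inj₂ (inj₂ (z<s , ≤-refl))

    -- The foot `suc t` separates the first spoke from everything after it; inside one spoke the
    -- centres differ.
    spokes-distinct : ∀ ℓ {t} → t < c → AllPairs _≁_ (spokeWindows ℓ t)
    spokes-distinct true  {zero}  _   = (centre≢⇒≁ c≢m ∷ []) ∷ [] ∷ []
    spokes-distinct false {zero}  _   = []
    spokes-distinct ℓ     {suc t} t<c = AllPairs.++⁺
      ((centre≢⇒≁ (<⇒≢ t<c ∘ sym) ∷ centre≢⇒≁ c≢m ∷ []) ∷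
       (centre≢⇒≁ (<⇒≢ (<-trans t<c c<m)) ∷ []) ∷ [] ∷ [])
      (spokes-distinct ℓ (<-trans (n<1+n t) t<c))
      (cross (suc-notOnSpokes t<c) (right ∷ centre ∷ left ∷ []) (spokes-on ℓ t))

    -- The three windows containing 0 have different centres, and 0 separates them from the rest.
    star-distinct : ∀ ℓ {t} → t < c → AllPairs _≁_ (starWindows ℓ t)
    star-distinct ℓ {t} t<c =
      ++⁺ (All.head (cross 0-notOnSpokes (left ∷ []) on))
          (centre≢⇒≁ (c≢m ∘ sym) ∷ centre≢⇒≁ (0≢m ∘ sym) ∷ []) ∷
      AllPairs.++⁺ (spokes-distinct ℓ t<c) ((centre≢⇒≁ (0≢c ∘ sym) ∷ []) ∷ [] ∷ [])
        (cross′ 0-notOnSpokes on (right ∷ centre ∷ []))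
      where
      on : All (Each (OnSpokes t)) (spokeWindows ℓ t)
      on = spokes-on ℓ t

-- Tails: prolongations by a new letter.

-- m ∷ s prolongs a word ending in 1 0, using the older letters below c only.
record Tail (m c : ℕ) (s : List ℕ) : Set where
  field
    windows  : List Window
    walk     : Walk 0 m s 1 0 windows
    distinct : AllPairs _≁_ (win 1 0 m ∷ windows)
    hub      : All (m ∈ʷ_) windows
    proper   : All Proper windows
    within   : All (Each (Below m c)) windows
    ending   : ∃[ p ] m ∷ s ≡ p ++ m ∷ 1 ∷ 0 ∷ []

Below-suc : ∀ {m c e} → Below m c e → Below m (suc c) e
Below-suc = [ inj₁ , inj₂ ∘ m<n⇒m<1+n ]′

Tail-suc : ∀ {m c s} → Tail m c s → Tail m (suc c) s
Tail-suc T = record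
  { windows = windows ; walk = walk ; distinct = distinct ; hub = hub ; proper = proper
  ; within = All.map (Each-map (λ {e} → Below-suc {_} {_} {e})) within ; ending = ending }
  where open Tail T

-- The star is closed at `0 m`, where the tail begins, so it can be inserted there. Its tip `c` lies
-- in all its windows, but in no window of the tail and not in `win 1 0 m`.
addStar : ∀ {m c s} ℓ {t} → 1 < c → c < m → t < c → Tail m c s →
          Tail m (suc c) (Star.star m c ℓ t ++ s)
addStar {m} {c} {s} ℓ {t} 1<c c<m t<c T = record
  { windows  = starWindows ℓ t ++ windows
  ; walk     = star-walk ℓ t ++ʷ walk
  ; distinct = ++⁺ (All.head (cross′ {P = Below m c} c∉tail
                                (each (inj₂ 1<c) (inj₂ 0<c) (inj₁ refl) ∷ []) tips))
                   (AllPairs.head distinct)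
               ∷ AllPairs.++⁺ (star-distinct 0<c c<m ℓ t<c) (AllPairs.tail distinct)
                   (cross {P = Below m c} c∉tail tips within)
  ; hub      = ++⁺ (All.map InStar.hub ins) hub
  ; proper   = ++⁺ (All.map InStar.proper ins) proper
  ; within   = ++⁺ (All.map InStar.within ins) (Tail.within (Tail-suc T))
  -- The closing `m` of the star becomes the hub in front of `s`.
  ; ending   = m ∷ c ∷ spokes ℓ t ++ 0 ∷ proj₁ ending , cong (λ r → m ∷ c ∷ r) (begin
      (spokes ℓ t ++ 0 ∷ m ∷ []) ++ s
        ≡⟨ ++-assoc (spokes ℓ t) _ s ⟩
      spokes ℓ t ++ 0 ∷ m ∷ s
        ≡⟨ cong (λ r → spokes ℓ t ++ 0 ∷ r) (proj₂ ending) ⟩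
      spokes ℓ t ++ 0 ∷ proj₁ ending ++ m ∷ 1 ∷ 0 ∷ []
        ≡⟨ ++-assoc (spokes ℓ t) _ _ ⟨
      (spokes ℓ t ++ 0 ∷ proj₁ ending) ++ m ∷ 1 ∷ 0 ∷ [] ∎)
  }
  where
  open ≡-Reasoning
  open Star m c
  open Tail T

  0<c : 0 < c
  0<c = <-trans z<s 1<c

  ins : All InStar (starWindows ℓ t)
  ins = star-inStar 0<c c<m ℓ t<c

  tips : All (c ∈ʷ_) (starWindows ℓ t)
  tips = All.map InStar.tip ins

  c∉tail : ¬ Below m c c
  c∉tail (inj₁ e) = <⇒≢ c<m e
  c∉tail (inj₂ e) = n≮n c e

-- Tails of prescribed length.

-- Up to reversal, A c proper windows contain a given letter and otherwise letters
-- among c others, and B k proper windows are formed from k letters.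
A : ℕ → ℕ
A zero    = 0
A (suc c) = A c + (3 * c + 2)

TailOfLength : ℕ → ℕ → ℕ → Set
TailOfLength m c L = ∃[ s ] (Tail m c s × suc (length s) ≡ L)

Tail-suc′ : ∀ {m c L} → TailOfLength m c L → TailOfLength m (suc c) L
Tail-suc′ (s , T , eq) = s , Tail-suc T , eq

addStar′ : ∀ {m c L} ℓ {t} → 1 < c → c < m → t < c → TailOfLength m c L →
           TailOfLength m (suc c) (loopSize ℓ + 3 * suc t + L)
addStar′ {m} {c} ℓ {t} 1<c c<m t<c (s , T , refl) = _ , addStar ℓ 1<c c<m t<c T , (begin
  suc (length (star ℓ t ++ s))          ≡⟨ cong suc (length-++ (star ℓ t)) ⟩
  suc (length (star ℓ t) + length s)    ≡⟨ +-suc (length (star ℓ t)) (length s) ⟨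
  length (star ℓ t) + suc (length s)    ≡⟨ cong (_+ suc (length s)) (star-length ℓ t) ⟩
  loopSize ℓ + 3 * suc t + suc (length s) ∎)
  where
  open ≡-Reasoning
  open Star m c

module _ (m : ℕ) where

  private
    h : ℕ
    h = 2 + m

    low : Below h 2 0
    low = inj₂ z<s

    low′ : Below h 2 1
    low′ = inj₂ (s<s z<s)

    top : Below h 2 h
    top = inj₁ refl

  -- The full core `h 0 h 1 h 1 0` meets all `A 2` = 7 windows made of `h` and the letters 0, 1. `r`
  -- counts the two-letter detours left out: first `0 h`, then `1 h`.
  coreTail : (r : Fin 3) → ∃[ L ] (TailOfLength h 2 L × 2 * toℕ r + L ≡ 7)
  coreTail zero = _ , (0 ∷ h ∷ 1 ∷ h ∷ 1 ∷ 0 ∷ [] , record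
    { windows  = _
    ; walk     = step (step (step (step (step (step stop)))))
    ; distinct = ((λ ()) ∷ (λ ()) ∷ (λ ()) ∷ (λ ()) ∷ (λ ()) ∷ (λ ()) ∷ []) ∷
                 ((λ ()) ∷ (λ ()) ∷ (λ ()) ∷ (λ ()) ∷ (λ ()) ∷ []) ∷
                 ((λ ()) ∷ (λ ()) ∷ (λ ()) ∷ (λ ()) ∷ []) ∷
                 ((λ ()) ∷ (λ ()) ∷ (λ ()) ∷ []) ∷
                 ((λ ()) ∷ (λ ()) ∷ []) ∷
                 ((λ ()) ∷ []) ∷ [] ∷ []
    ; hub      = centre ∷ left ∷ centre ∷ left ∷ centre ∷ left ∷ []
    ; proper   = ((λ ()) , λ ()) ∷ ((λ ()) , λ ()) ∷ ((λ ()) , λ ()) ∷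
                 ((λ ()) , λ ()) ∷ ((λ ()) , λ ()) ∷ ((λ ()) , λ ()) ∷ []
    ; within   = each low top low ∷ each top low top ∷ each low top low′ ∷
                 each top low′ top ∷ each low′ top low′ ∷ each top low′ low ∷ []
    ; ending   = _ ∷ _ ∷ _ ∷ _ ∷ [] , refl
    } , refl) , refl
  coreTail (suc zero) = _ , (1 ∷ h ∷ 1 ∷ 0 ∷ [] , record
    { windows  = _
    ; walk     = step (step (step (step stop)))
    ; distinct = ((λ ()) ∷ (λ ()) ∷ (λ ()) ∷ (λ ()) ∷ []) ∷
                 ((λ ()) ∷ (λ ()) ∷ (λ ()) ∷ []) ∷
                 ((λ ()) ∷ (λ ()) ∷ []) ∷
                 ((λ ()) ∷ []) ∷ [] ∷ []
    ; hub      = centre ∷ left ∷ centre ∷ left ∷ []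
    ; proper   = ((λ ()) , λ ()) ∷ ((λ ()) , λ ()) ∷ ((λ ()) , λ ()) ∷ ((λ ()) , λ ()) ∷ []
    ; within   = each low top low′ ∷ each top low′ top ∷ each low′ top low′ ∷ each top low′ low ∷ []
    ; ending   = _ ∷ _ ∷ [] , refl
    } , refl) , refl
  coreTail (suc (suc zero)) = _ , (1 ∷ 0 ∷ [] , record
    { windows  = _
    ; walk     = step (step stop)
    ; distinct = ((λ ()) ∷ (λ ()) ∷ []) ∷ ((λ ()) ∷ []) ∷ [] ∷ []
    ; hub      = centre ∷ left ∷ []
    ; proper   = ((λ ()) , λ ()) ∷ ((λ ()) , λ ()) ∷ []
    ; within   = each low top low′ ∷ each top low′ low ∷ []
    ; ending   = [] , refl
    } , refl) , refl

-- All stars are complete and only the core is shortened; a complete star at tip `c` has 3c + 2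
-- letters, the increment of `A`.
fullTail : ∀ m j → 2 + j ≤ 2 + m → (r : Fin 3) →
           ∃[ L ] (TailOfLength (2 + m) (2 + j) L × 2 * toℕ r + L ≡ A (2 + j))
fullTail m zero    _   r = coreTail m r
fullTail m (suc j) c<m r =
  let L , T , eq = fullTail m j (<⇒≤ c<m) r
  in _ , addStar′ true {suc j} (s<s z<s) c<m ≤-refl T ,
     trans (lemma (2 * toℕ r) j L) (cong (_+ (3 * (2 + j) + 2)) eq)
  where
  lemma : ∀ x j L → x + (2 + 3 * (2 + j) + L) ≡ x + L + (3 * (2 + j) + 2)
  lemma = solve-∀

residue₃ : ∀ e → ∃[ s ] (e ≡ 3 * s ⊎ e ≡ 1 + 3 * s ⊎ e ≡ 2 + 3 * s)
residue₃ zero                = 0 , inj₁ refl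
residue₃ (suc zero)          = 0 , inj₂ (inj₁ refl)
residue₃ (suc (suc zero))    = 0 , inj₂ (inj₂ refl)
residue₃ (suc (suc (suc e))) with residue₃ e
... | s , inj₁ refl        = suc s , inj₁ (sym (*-suc 3 s))
... | s , inj₂ (inj₁ refl) = suc s , inj₂ (inj₁ (cong suc (sym (*-suc 3 s))))
... | s , inj₂ (inj₂ refl) = suc s , inj₂ (inj₂ (cong (2 +_) (sym (*-suc 3 s))))

3*s≤3*c+2⇒s≤c : ∀ {s c} → 3 * s ≤ 3 * c + 2 → s ≤ c
3*s≤3*c+2⇒s≤c {s} {c} le = s≤s⁻¹ (*-cancelˡ-< 3 s (suc c) (begin-strict
  3 * s       ≤⟨ le ⟩
  3 * c + 2   <⟨ +-monoʳ-< (3 * c) (n<1+n 2) ⟩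
  3 * c + 3   ≡⟨ +-comm (3 * c) 3 ⟩
  3 + 3 * c   ≡⟨ *-suc 3 c ⟨
  3 * suc c   ∎))
  where open ≤-Reasoning

-- Only the last star and the core are shortened, in pieces of 3 and 2 letters. The excluded lengths
-- are one above the shortest tail and one below the full one: such pieces never add up to 1.
tailOfLength : ∀ m j → 2 + j ≤ 2 + m → ∀ L → 3 ≤ L → L ≢ 4 → L ≤ A (2 + j) →
               suc L ≢ A (2 + j) → TailOfLength (2 + m) (2 + j) L
tailOfLength m zero _ 0 () _ _ _
tailOfLength m zero _ 1 (s≤s ()) _ _ _
tailOfLength m zero _ 2 (s≤s (s≤s ())) _ _ _
tailOfLength m zero _ 3 _ _ _ _ =
  let L , T , eq = coreTail m (suc (suc zero))
  in subst (TailOfLength _ _) (+-cancelˡ-≡ 4 L 3 eq) T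
tailOfLength m zero _ 4 _ L≢4 _ _ = contradiction refl L≢4
tailOfLength m zero _ 5 _ _ _ _ =
  let L , T , eq = coreTail m (suc zero)
  in subst (TailOfLength _ _) (+-cancelˡ-≡ 2 L 5 eq) T
tailOfLength m zero _ 6 _ _ _ 7≢7 = contradiction refl 7≢7
tailOfLength m zero _ 7 _ _ _ _ =
  let L , T , eq = coreTail m zero in subst (TailOfLength _ _) eq T
tailOfLength m zero _ (suc (suc (suc (suc (suc (suc (suc (suc L)))))))) _ _ 8+L≤7 _ =
  contradiction (+-cancelˡ-≤ 7 (suc L) 0 8+L≤7) λ ()
tailOfLength m (suc j) c<m L 3≤L L≢4 L≤A L≢A-1 with <-cmp (suc L) (A (2 + j))
... | tri< L+1<A L+1≢A _ =
  Tail-suc′ (tailOfLength m j (<⇒≤ c<m) L 3≤L L≢4 (<⇒≤ (<-trans (n<1+n L) L+1<A)) L+1≢A)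
-- A (2 + j) - 1 = (A (2 + j) - 4) + 3: the core loses both detours and the shortest star is added.
... | tri≈ _ L+1≡A _ =
  let L′ , T , eq = fullTail m j (<⇒≤ c<m) (suc (suc zero))
  in subst (TailOfLength _ _) (suc-injective (trans eq (sym L+1≡A)))
       (addStar′ false {0} (s<s z<s) c<m z<s T)
... | tri> _ _ A≤L with m≤n⇒∃[o]m+o≡n (s≤s⁻¹ A≤L)
...   | e , refl = byResidue (residue₃ e)
  where
  c = 2 + j

  e≤ : e ≤ 3 * c + 2
  e≤ = +-cancelˡ-≤ (A c) e (3 * c + 2) L≤A

  full : (r : Fin 3) → ∃[ L ] (TailOfLength (2 + m) c L × 2 * toℕ r + L ≡ A c)
  full = fullTail m j (<⇒≤ c<m)

  byResidue : ∃[ s ] (e ≡ 3 * s ⊎ e ≡ 1 + 3 * s ⊎ e ≡ 2 + 3 * s) →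
              TailOfLength (2 + m) (suc c) (A c + e)
  byResidue (zero , inj₁ refl) =
    let L , T , eq = full zero
    in subst (TailOfLength _ _) (trans eq (sym (+-identityʳ (A c)))) (Tail-suc′ T)
  byResidue (suc t , inj₁ refl) =
    let L , T , eq = full zero
    in subst (TailOfLength _ _) (trans (+-comm _ L) (cong (_+ 3 * suc t) eq))
         (addStar′ false (s<s z<s) c<m (3*s≤3*c+2⇒s≤c e≤) T)
  -- 1 + 3s = 3(s + 1) - 2, the 2 being taken from the core. The star has room for this unless s =
  -- c, which is the excluded length.
  byResidue (s , inj₂ (inj₁ refl)) =
    let L , T , eq = full (suc zero)
    in subst (TailOfLength _ _) (trans (lemma s L) (cong (_+ (1 + 3 * s)) eq))
         (addStar′ false (s<s z<s) c<m s<c T)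
    where
    s≢c : s ≢ c
    s≢c refl = L≢A-1 (trans (sym (+-suc (A c) _)) (cong (A c +_) (+-comm 2 (3 * c))))
    s<c : s < c
    s<c = ≤∧≢⇒< (3*s≤3*c+2⇒s≤c (≤-trans (n≤1+n _) e≤)) s≢c
    lemma : ∀ s L → 3 * suc s + L ≡ 2 + L + (1 + 3 * s)
    lemma = solve-∀
  -- 2 = 6 - 4: no star with a loop has length 2, so the core gives up 4.
  byResidue (zero , inj₂ (inj₂ refl)) =
    let L , T , eq = full (suc (suc zero))
    in subst (TailOfLength _ _) (trans (lemma L) (cong (_+ 2) eq))
         (addStar′ false {1} (s<s z<s) c<m (s<s z<s) T)
    where
    lemma : ∀ L → 6 + L ≡ 4 + L + 2
    lemma = solve-∀
  byResidue (suc t , inj₂ (inj₂ refl)) =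
    let L , T , eq = full zero
    in subst (TailOfLength _ _) (trans (+-comm _ L) (cong (_+ (2 + 3 * suc t)) eq))
         (addStar′ true (s<s z<s) c<m (3*s≤3*c+2⇒s≤c (≤-trans (m≤n+m (3 * suc t) 2) e≤)) T)

-- Words and their prolongations.

-- win 1 0 1 and win b a b are the windows of the last and the first letter.
record Trail (k a b : ℕ) (s : List ℕ) : Set where
  field
    windows  : List Window
    walk     : Walk a b s 1 0 windows
    distinct : AllPairs _≁_ (win 1 0 1 ∷ win b a b ∷ windows)
    proper   : All Proper (win b a b ∷ windows)
    letters  : All (Each (_< k)) (win b a b ∷ windows)
    onto     : ∀ c → c < k → c ∈ a ∷ b ∷ s

-- All new windows, including `win 1 0 k` at the joint, contain `k`, which the old word lacks. The
-- joint frees `win 1 0 1`, which serves again as the end window of the longer word.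
extend : ∀ {k a b s s′} → 1 < k → Trail k a b s → Tail k k s′ → Trail (suc k) a b (s ++ k ∷ s′)
extend {k} {a} {b} {s} {s′} 1<k W T = record
  { windows  = W.windows ++ win 1 0 k ∷ T.windows
  ; walk     = W.walk ++ʷ step T.walk
  ; distinct = AllPairs.++⁺ W.distinct T.distinct
      (cross′ (n≮n k) (each 1<k 0<k 1<k ∷ W.letters) (right ∷ T.hub))
  ; proper   = ++⁺ W.proper (((λ ()) , <⇒≢ 0<k) ∷ T.proper)
  ; letters  = ++⁺ (All.map (Each-map m<n⇒m<1+n) W.letters)
      (each (m<n⇒m<1+n 1<k) (m<n⇒m<1+n 0<k) ≤-refl ∷
       All.map (Each-map [ (λ { refl → ≤-refl }) , m<n⇒m<1+n ]′) T.within)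
  ; onto     = λ c c<1+k → [ ∈-++⁺ˡ ∘ W.onto c , (λ { refl → ∈-++⁺ʳ (a ∷ b ∷ s) (here refl) }) ]′
                             (m<1+n⇒m<n∨m≡n c<1+k)
  }
  where
  module W = Trail W
  module T = Tail T
  0<k : 0 < k
  0<k = <-trans z<s 1<k

B : ℕ → ℕ
B zero    = 0
B (suc k) = B k + A k

Word : ℕ → ℕ → ℕ → ℕ → Set
Word k n a b = ∃[ s ] (Trail k a b s × 2 + length s ≡ n)

TopWord : ℕ → ℕ → ℕ → ℕ → Set
TopWord k n a b =
  ∃[ s ] (Trail (suc k) a b s × 2 + length s ≡ n × ∃[ p ] a ∷ b ∷ s ≡ p ++ k ∷ 1 ∷ 0 ∷ [])

TopWord⇒Word : ∀ {k n a b} → TopWord k n a b → Word (suc k) n a b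
TopWord⇒Word (s , W , eq , _) = s , W , eq

extendWord : ∀ {k n L a b} → 1 < k → Word k n a b → TailOfLength k k L → TopWord k (n + L) a b
extendWord {k} {a = a} {b} 1<k (s , W , refl) (s′ , T , refl) =
  _ , extend 1<k W T , cong (2 +_) (length-++ s) ,
  a ∷ b ∷ s ++ proj₁ (Tail.ending T) ,
  cong (λ r → a ∷ b ∷ r) (trans (cong (s ++_) (proj₂ (Tail.ending T)))
                                (sym (++-assoc s _ _)))

_~?_ : ∀ v w → Dec (v ~ w)
win a b c ~? win a′ b′ c′ with b ≟ b′
... | no b≢b′ = no (centre≢⇒≁ b≢b′)
... | yes refl with a ≟ a′ ×-dec c ≟ c′
...   | yes (refl , refl) = yes same
...   | no ≢same with a ≟ c′ ×-dec c ≟ a′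
...     | yes (refl , refl) = yes flip
...     | no ≢flip = no λ { same → ≢same (refl , refl) ; flip → ≢flip (refl , refl) }

proper? : ∀ w → Dec (Proper w)
proper? (win a b c) = ¬? (a ≟ b) ×-dec ¬? (b ≟ c)

each<? : ∀ k w → Dec (Each (_< k) w)
each<? k (win a b c) =
  map′ (λ (a< , b< , c<) → each a< b< c<) (λ { (each a< b< c<) → a< , b< , c< })
       (a <? k ×-dec b <? k ×-dec c <? k)

-- For a concrete word every condition is decided by evaluation, so only the walk has to be
-- supplied.
trail : ∀ {k a b s ws} → Walk a b s 1 0 ws →
  {True (allPairs? (λ v w → ¬? (v ~? w)) (win 1 0 1 ∷ win b a b ∷ ws))} →
  {True (All.all? proper? (win b a b ∷ ws))} → {True (All.all? (each<? k) (win b a b ∷ ws))} →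
  {True (allUpTo? (_∈? a ∷ b ∷ s) k)} → Trail k a b s
trail W {distinct} {proper} {letters} {onto} = record
  { windows  = _
  ; walk     = W
  ; distinct = toWitness distinct
  ; proper   = toWitness proper
  ; letters  = toWitness letters
  ; onto     = λ c c<k → toWitness onto {c} c<k
  }

word₂ : Word 2 2 1 0
word₂ = [] , trail stop , refl

-- Core tails prolong `word₂` to the lengths 5, 7 and 9 only; the lengths 3, 4, 6 and 8 on three
-- letters are given by explicit words.
word₃ : Word 3 3 2 1
word₃ = 0 ∷ [] , trail (step stop) , refl

word₄ : Word 3 4 0 2
word₄ = 1 ∷ 0 ∷ [] , trail (step (step stop)) , refl

word₆ : Word 3 6 2 1
word₆ = 2 ∷ 0 ∷ 1 ∷ 0 ∷ [] , trail (step (step (step (step stop)))) , refl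

-- A word that ends in 1 0 and misses exactly one window cannot also start with 1 0.
word₈ : Word 3 8 2 1
word₈ = 2 ∷ 0 ∷ 2 ∷ 0 ∷ 1 ∷ 0 ∷ [] , trail (step (step (step (step (step (step stop)))))) , refl

mutual
  -- Being as long as the number of windows available, this word uses each of them exactly once up
  -- to reversal.
  fullWord : ∀ j → Word (2 + j) (B (2 + j)) 1 0
  fullWord zero    = word₂
  fullWord (suc j) =
    let n , W , eq = nearlyFullWord j zero in subst (λ n → Word (3 + j) n 1 0) eq (TopWord⇒Word W)

  nearlyFullWord : ∀ j (r : Fin 3) → ∃[ n ] (TopWord (2 + j) n 1 0 × 2 * toℕ r + n ≡ B (3 + j))
  nearlyFullWord j r =
    let L , T , eq = fullTail j j ≤-refl r
    in _ , extendWord (s<s z<s) (fullWord j) T ,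
       trans (lemma (2 * toℕ r) (B (2 + j)) L) (cong (B (2 + j) +_) eq)
    where
    lemma : ∀ x b L → x + (b + L) ≡ b + (x + L)
    lemma = solve-∀

15≤A : ∀ j → 15 ≤ A (3 + j)
15≤A zero    = ≤-refl
15≤A (suc j) = ≤-trans (15≤A j) (m≤m+n (A (3 + j)) _)

-- A full word on the old letters is prolonged by a tail of length `L` where one exists. The length
-- one below the full one is left to `almostTop`.
wordOfLength : ∀ j L → 1 ≤ L → L ≤ A (3 + j) → suc L ≢ A (3 + j) →
               TopWord (3 + j) (B (3 + j) + L) 1 0
wordOfLength j = go
  where
  tail : ∀ L → 3 ≤ L → L ≢ 4 → L ≤ A (3 + j) → suc L ≢ A (3 + j) → TailOfLength (3 + j) (3 + j) L
  tail = tailOfLength (suc j) (suc j) ≤-refl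

  tail₃ : TailOfLength (3 + j) (3 + j) 3
  tail₃ = tail 3 ≤-refl (λ ()) (≤-trans (m≤m+n 3 12) (15≤A j))
               (<⇒≢ (≤-trans (m≤m+n 5 10) (15≤A j)))

  tail₆ : TailOfLength (3 + j) (3 + j) 6
  tail₆ = tail 6 (m≤m+n 3 3) (λ ()) (≤-trans (m≤m+n 6 9) (15≤A j))
               (<⇒≢ (≤-trans (m≤m+n 8 7) (15≤A j)))

  -- Extensions of length 1, 2 and 4 do not exist; a shorter word is extended instead.
  viaShorter : (r : Fin 3) → ∀ {L L′} → TailOfLength (3 + j) (3 + j) L′ → L′ ≡ 2 * toℕ r + L →
               TopWord (3 + j) (B (3 + j) + L) 1 0
  viaShorter r {L} {L′} T refl =
    let n , W , eq = nearlyFullWord j r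
    in subst (λ n → TopWord (3 + j) n 1 0)
         (trans (lemma n (2 * toℕ r) L) (cong (_+ L) eq))
         (extendWord (s<s z<s) (TopWord⇒Word W) T)
    where
    lemma : ∀ n x L → n + (x + L) ≡ x + n + L
    lemma = solve-∀

  go : ∀ L → 1 ≤ L → L ≤ A (3 + j) → suc L ≢ A (3 + j) → TopWord (3 + j) (B (3 + j) + L) 1 0
  -- 1 = 3 - 2, 2 = 6 - 4 and 4 = 6 - 2: a tail of 3 or 6 letters follows a word lacking 2 or 4.
  go 1 _ _ _ = viaShorter (suc zero) tail₃ refl
  go 2 _ _ _ = viaShorter (suc (suc zero)) tail₆ refl
  go 4 _ _ _ = viaShorter (suc zero) tail₆ refl
  go 3 _ _ _ = extendWord (s<s z<s) (fullWord (suc j)) tail₃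
  go L@(suc (suc (suc (suc (suc _))))) _ L≤A L≢A-1 =
    extendWord (s<s z<s) (fullWord (suc j)) (tail L (s≤s (s≤s (s≤s z≤n))) (λ ()) L≤A L≢A-1)

-- `word₈` is one letter short of `B 3` = 9, and full tails preserve this deficit.
almostWord : ∀ j → ∃[ n ] (Word (3 + j) n 2 1 × suc n ≡ B (3 + j))
almostTop : ∀ j → ∃[ n ] (TopWord (3 + j) n 2 1 × suc n ≡ B (4 + j))

almostWord zero    = 8 , word₈ , refl
almostWord (suc j) = let n , W , eq = almostTop j in n , TopWord⇒Word W , eq

almostTop j =
  let n , W , eq  = almostWord j
      L , T , eq′ = fullTail (suc j) (suc j) ≤-refl zero
  in n + L , extendWord (s<s z<s) W T , cong₂ _+_ eq eq′

-- Positions in a word and neighbour colours in a path.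

data _at_is_ {X : Set} : List X → ℕ → X → Set where
  zeroth : ∀ {x xs} → (x ∷ xs) at 0 is x
  later  : ∀ {x y xs i} → xs at i is y → (x ∷ xs) at suc i is y

at-functional : ∀ {X : Set} {xs : List X} {i x y} → xs at i is x → xs at i is y → x ≡ y
at-functional zeroth    zeroth    = refl
at-functional (later p) (later q) = at-functional p q

at-lookup : ∀ {X : Set} (xs : List X) u → xs at toℕ u is lookup xs u
at-lookup (x ∷ xs) zero    = zeroth
at-lookup (x ∷ xs) (suc u) = later (at-lookup xs u)

at-index : ∀ {X : Set} {xs : List X} {i x} → xs at i is x → ∃[ u ] (toℕ u ≡ i × lookup xs u ≡ x)
at-index zeroth    = zero , refl , refl
at-index (later p) = let u , e , e′ = at-index p in suc u , cong suc e , e′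

at-++ : ∀ {X : Set} (xs : List X) {ys i y} → ys at i is y → (xs ++ ys) at length xs + i is y
at-++ []       p = p
at-++ (x ∷ xs) p = later (at-++ xs p)

All-at : ∀ {X : Set} {P : X → Set} {xs i x} → All P xs → xs at i is x → P x
All-at (px ∷ _)  zeroth    = px
All-at (_ ∷ pxs) (later p) = All-at pxs p

AllPairs-at : ∀ {xs i j v w} → AllPairs _≁_ xs → xs at i is v → xs at j is w → i ≢ j → v ≁ w
AllPairs-at (_ ∷ _)  zeroth    zeroth    i≢j = contradiction refl i≢j
AllPairs-at (p ∷ _)  zeroth    (later q) _   = All-at p q
AllPairs-at (p ∷ _)  (later q) zeroth    _   = ≁-sym (All-at p q)
AllPairs-at (_ ∷ ps) (later p) (later q) i≢j = AllPairs-at ps p q (i≢j ∘ cong suc)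

Near : ℕ → ℕ → Set
Near i j = j ≡ suc i ⊎ i ≡ suc j

-- The two neighbours coincide when i is an end of the word.
record Sides (w : List ℕ) (i p q : ℕ) : Set where
  field
    one   : ∃[ j ] (Near i j × w at j is p)
    other : ∃[ j ] (Near i j × w at j is q)
    only  : ∀ {j e} → Near i j → w at j is e → e ≡ p ⊎ e ≡ q

-- With the end window appended, windows and letters of `y ∷ s` share their indices. The second
-- alternative is the last letter, which has no right neighbour.
walk-at : ∀ {x y s x′ y′ ws i e} → Walk x y s x′ y′ ws → (y ∷ s) at i is e →
  ∃[ p ] ∃[ q ] ((ws ++ win x′ y′ x′ ∷ []) at i is win p e q × (x ∷ y ∷ s) at i is p ×
    ((x ∷ y ∷ s) at 2 + i is q ⊎ (p ≡ q × ∀ {e′} → ¬ ((x ∷ y ∷ s) at 2 + i is e′))))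
walk-at stop     zeroth    = _ , _ , zeroth , zeroth , inj₂ (refl , λ { (later (later ())) })
walk-at (step W) zeroth    = _ , _ , zeroth , zeroth , inj₁ (later (later zeroth))
walk-at (step W) (later i) with walk-at W i
... | p , q , atᵢ , atₚ , inj₁ at-q         = p , q , later atᵢ , later atₚ , inj₁ (later at-q)
... | p , q , atᵢ , atₚ , inj₂ (p≡q , none) =
  p , q , later atᵢ , later atₚ , inj₂ (p≡q , λ { (later at-e) → none at-e })

record NbrColours {n k : ℕ} (f : Fin n → Fin k) (u : Fin n) (p q : Fin k) : Set where
  field
    one   : image f (N (path n) u) p
    other : image f (N (path n) u) q
    only  : ∀ {c} → image f (N (path n) u) c → c ≡ p ⊎ c ≡ q

SamePair : {X : Set} → X → X → X → X → Set
SamePair p q p′ q′ = (p ≡ p′ × q ≡ q′) ⊎ (p ≡ q′ × q ≡ p′)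

module _ {n k : ℕ} {f : Fin n → Fin k} {u v p q p′ q′}
         (U : NbrColours f u p q) (V : NbrColours f v p′ q′) where

  private
    module U = NbrColours U
    module V = NbrColours V

  -- An unordered pair is determined by its set of entries. Hence neighbour sets can be compared as
  -- windows up to reversal.
  sameImage⇒samePair : image f (N (path n) u) ≐ image f (N (path n) v) → SamePair p q p′ q′
  sameImage⇒samePair (u⊆v , v⊆u)
    with V.only (u⊆v U.one) | V.only (u⊆v U.other) | U.only (v⊆u V.one) | U.only (v⊆u V.other)
  ... | inj₁ refl | inj₂ refl | _         | _         = inj₁ (refl , refl)
  ... | inj₂ refl | inj₁ refl | _         | _         = inj₂ (refl , refl)
  ... | inj₁ refl | inj₁ refl | _         | inj₁ refl = inj₁ (refl , refl)
  ... | inj₁ refl | inj₁ refl | _         | inj₂ refl = inj₁ (refl , refl)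
  ... | inj₂ refl | inj₂ refl | inj₁ refl | _         = inj₁ (refl , refl)
  ... | inj₂ refl | inj₂ refl | inj₂ refl | _         = inj₁ (refl , refl)

  samePair⇒sameImage : SamePair p q p′ q′ → image f (N (path n) u) ≐ image f (N (path n) v)
  samePair⇒sameImage (inj₁ (refl , refl)) = toV , toU
    where
    toV : ∀ {c} → image f (N (path n) u) c → image f (N (path n) v) c
    toV c∈ with U.only c∈
    ... | inj₁ refl = V.one
    ... | inj₂ refl = V.other
    toU : ∀ {c} → image f (N (path n) v) c → image f (N (path n) u) c
    toU c∈ with V.only c∈
    ... | inj₁ refl = U.one
    ... | inj₂ refl = U.other
  samePair⇒sameImage (inj₂ (refl , refl)) = toV , toU
    where
    toV : ∀ {c} → image f (N (path n) u) c → image f (N (path n) v) c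
    toV c∈ with U.only c∈
    ... | inj₁ refl = V.other
    ... | inj₂ refl = V.one
    toU : ∀ {c} → image f (N (path n) v) c → image f (N (path n) u) c
    toU c∈ with V.only c∈
    ... | inj₁ refl = U.other
    ... | inj₂ refl = U.one

-- The colouring read off a word.

module Colouring {k a b s} (1<k : 1 < k) (W : Trail k a b s) where
  open Trail W

  word : List ℕ
  word = a ∷ b ∷ s

  -- Listed in vertex order, so that a vertex and its window have the same index.
  allWindows : List Window
  allWindows = win b a b ∷ windows ++ win 1 0 1 ∷ []

  allWindows-distinct : AllPairs _≁_ allWindows
  allWindows-distinct = AllPairs.++⁺ (AllPairs.tail distinct) ([] ∷ [])
    (All.map (λ p → ≁-sym p ∷ []) (AllPairs.head distinct))

  allWindows-proper : All Proper allWindows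
  allWindows-proper = ++⁺ proper (((λ ()) , λ ()) ∷ [])

  allWindows-letters : All (Each (_< k)) allWindows
  allWindows-letters = ++⁺ letters (each 1<k (<-trans z<s 1<k) 1<k ∷ [])

  windowAt : ∀ {i e} → word at i is e →
             ∃[ p ] ∃[ q ] (allWindows at i is win p e q × Sides word i p q)
  windowAt zeroth = b , b , zeroth , record
    { one   = 1 , inj₁ refl , later zeroth
    ; other = 1 , inj₁ refl , later zeroth
    ; only  = λ { (inj₁ refl) (later zeroth) → inj₁ refl }
    }
  windowAt (later {i = i} at-e) with walk-at walk at-e
  ... | p , q , atᵢ , atₚ , inj₁ at-q = p , q , later atᵢ , record
    { one   = i , inj₂ refl , atₚ
    ; other = 2 + i , inj₁ refl , at-q
    ; only  = λ { (inj₁ refl) at-e → inj₂ (at-functional at-e at-q)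
                ; (inj₂ refl) at-e → inj₁ (at-functional at-e atₚ) }
    }
  ... | p , q , atᵢ , atₚ , inj₂ (refl , none) = p , q , later atᵢ , record
    { one   = i , inj₂ refl , atₚ
    ; other = i , inj₂ refl , atₚ
    ; only  = λ { (inj₁ refl) at-e → contradiction at-e none
                ; (inj₂ refl) at-e → inj₁ (at-functional at-e atₚ) }
    }

  letter<k : ∀ {i e} → word at i is e → e < k
  letter<k at-e with windowAt at-e
  ... | _ , _ , atᵢ , _ with All-at allWindows-letters atᵢ
  ...   | each _ e<k _ = e<k

  f : Fin (length word) → Fin k
  f u = fromℕ< (letter<k (at-lookup word u))

  f-at : ∀ u → word at toℕ u is toℕ (f u)
  f-at u = subst (word at toℕ u is_) (sym (toℕ-fromℕ< _)) (at-lookup word u)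

  at⇒vertex : ∀ {i e} → word at i is e → ∃[ u ] (toℕ u ≡ i × toℕ (f u) ≡ e)
  at⇒vertex at-e =
    let u , u≡i , eq = at-index at-e in u , u≡i , trans (toℕ-fromℕ< _) eq

  near⇒adj : ∀ {u v : Fin (length word)} → Near (toℕ u) (toℕ v) → Adj (path (length word)) u v
  near⇒adj = [ inj₁ ∘ cong suc , inj₂ ∘ cong suc ]′

  adj⇒near : ∀ {u v : Fin (length word)} → Adj (path (length word)) u v → Near (toℕ u) (toℕ v)
  adj⇒near = [ inj₁ ∘ suc-injective , inj₂ ∘ suc-injective ]′

  nbrColours : ∀ u → ∃[ p ] ∃[ q ] (NbrColours f u p q ×
               allWindows at toℕ u is win (toℕ p) (toℕ (f u)) (toℕ q))
  nbrColours u with windowAt (f-at u)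
  ... | p , q , atᵤ , S
    with j , near-j , at-j ← Sides.one S | j′ , near-j′ , at-j′ ← Sides.other S
    with x , refl , refl ← at⇒vertex at-j | y , refl , refl ← at⇒vertex at-j′
    = f x , f y , record
      { one   = x , near⇒adj near-j , refl
      ; other = y , near⇒adj near-j′ , refl
      ; only  = λ { (z , adj , refl) →
          [ inj₁ ∘ toℕ-injective , inj₂ ∘ toℕ-injective ]′ (Sides.only S (adj⇒near adj) (f-at z)) }
      } , atᵤ

  f-onto : Surjective _≡_ _≡_ f
  f-onto c with at⇒vertex (∈⇒at (onto (toℕ c) (toℕ<n c)))
    where
    ∈⇒at : ∀ {xs : List ℕ} {x} (x∈xs : x ∈ xs) → xs at toℕ (Any.index x∈xs) is x
    ∈⇒at (here refl) = zeroth
    ∈⇒at (there x∈)  = later (∈⇒at x∈)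
  ... | u , _ , eq = u , λ { refl → toℕ-injective eq }

  f-proper : ∀ u v → Adj (path (length word)) u v → f u ≢ f v
  f-proper u v adj fu≡fv with nbrColours u
  ... | p , q , U , atᵤ with All-at allWindows-proper atᵤ | NbrColours.only U (v , adj , refl)
  ...   | p≢ , _ | inj₁ refl = p≢ (cong toℕ (sym fu≡fv))
  ...   | _ , ≢q | inj₂ refl = ≢q (cong toℕ fu≡fv)

  f-locating : ∀ u v → u ≢ v → f u ≡ f v →
               ¬ (image f (N (path (length word)) u) ≐ image f (N (path (length word)) v))
  f-locating u v u≢v fu≡fv same-image with nbrColours u | nbrColours v
  ... | p , q , U , atᵤ | p′ , q′ , V , atᵥ
    with AllPairs-at allWindows-distinct atᵤ atᵥ (u≢v ∘ toℕ-injective)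
       | sameImage⇒samePair U V same-image
  ...   | ≁ | inj₁ (refl , refl) rewrite fu≡fv = ≁ same
  ...   | ≁ | inj₂ (refl , refl) rewrite fu≡fv = ≁ flip

  isNeighborLocating : IsNeighborLocating (path (length word)) k f
  isNeighborLocating = record
    { isProperColoring = record { onto = f-onto ; proper = f-proper }
    ; locating         = f-locating
    }

-- Counting codes to bound the order of the path.

-- At an end of the path the only neighbour is listed twice.
pathNeighbours : ∀ {n} → 2 ≤ n → (u : Fin n) →
  ∃[ v ] ∃[ w ] (Adj (path n) u v × Adj (path n) u w × (∀ x → Adj (path n) u x → x ≡ v ⊎ x ≡ w))
pathNeighbours (s≤s (s≤s _)) zero =
  suc zero , suc zero , inj₁ refl , inj₁ refl ,
  λ { x (inj₁ eq) → inj₁ (toℕ-injective (suc-injective eq)) }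
pathNeighbours {n} _ (suc i) with 2 + toℕ i <? n
... | yes i+2<n = inject₁ i , fromℕ< i+2<n , inj₂ below , inj₁ above ,
  λ { x (inj₁ eq) → inj₂ (toℕ-injective (suc-injective (trans eq (sym above))))
    ; x (inj₂ eq) → inj₁ (toℕ-injective (suc-injective (suc-injective (trans (sym eq) below)))) }
  where
  below : number (suc i) ≡ suc (number (inject₁ i))
  below = cong (2 +_) (sym (toℕ-inject₁ i))
  above : number (fromℕ< i+2<n) ≡ suc (number (suc i))
  above = cong suc (toℕ-fromℕ< i+2<n)
... | no i+2≮n = inject₁ i , inject₁ i , inj₂ below , inj₂ below ,
  λ { x (inj₁ eq) → contradiction (subst (_< n) (suc-injective eq) (toℕ<n x)) i+2≮n
    ; x (inj₂ eq) → inj₁ (toℕ-injective (suc-injective (suc-injective (trans (sym eq) below)))) }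
  where
  below : number (suc i) ≡ suc (number (inject₁ i))
  below = cong (2 +_) (sym (toℕ-inject₁ i))

-- Neighbour colours differ from `c`, so `c` is free as a marker: z = c says that both equal `x`,
-- and otherwise they are `x` and `z`.
Decodes : ∀ {k} → Fin k → Fin k → Fin k → Fin k × Fin k → Set
Decodes c p q (x , z) = (z ≡ c × x ≡ p × x ≡ q) ⊎ (z ≢ c × SamePair x z p q)

-- Two codes (x , z) with x ≢ c for each unordered pair {p , q} of colours other
-- than c: the two orderings of the pair if p ≢ q, and (p , p), (p , c) if p ≡ q.
module PairCode {k : ℕ} (c p q : Fin k) (p≢c : p ≢ c) (q≢c : q ≢ c) where

  code : Fin 2 → Fin k × Fin k
  code i with p Fin.≟ q
  code zero       | yes _ = p , p
  code (suc zero) | yes _ = p , c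
  code zero       | no  _ = p , q
  code (suc zero) | no  _ = q , p

  code-≢c : ∀ i → proj₁ (code i) ≢ c
  code-≢c i with p Fin.≟ q
  code-≢c zero       | yes _ = p≢c
  code-≢c (suc zero) | yes _ = p≢c
  code-≢c zero       | no  _ = p≢c
  code-≢c (suc zero) | no  _ = q≢c

  code-injective : ∀ i j → code i ≡ code j → i ≡ j
  code-injective i j eq with p Fin.≟ q
  code-injective zero       zero       _  | _      = refl
  code-injective (suc zero) (suc zero) _  | _      = refl
  code-injective zero       (suc zero) eq | yes _  = contradiction (cong proj₂ eq) p≢c
  code-injective (suc zero) zero       eq | yes _  = contradiction (sym (cong proj₂ eq)) p≢c
  code-injective zero       (suc zero) eq | no p≢q = contradiction (cong proj₁ eq) p≢q
  code-injective (suc zero) zero       eq | no p≢q = contradiction (cong proj₂ eq) p≢q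

  code-decodes : ∀ i → Decodes c p q (code i)
  code-decodes i with p Fin.≟ q
  code-decodes zero       | yes p≡q = inj₂ (p≢c , inj₁ (refl , p≡q))
  code-decodes (suc zero) | yes p≡q = inj₁ (refl , refl , p≡q)
  code-decodes zero       | no  _   = inj₂ (q≢c , inj₁ (refl , refl))
  code-decodes (suc zero) | no  _   = inj₂ (p≢c , inj₂ (refl , refl))

SamePair-join : {X : Set} {x z p q p′ q′ : X} → SamePair x z p q → SamePair x z p′ q′ →
                SamePair p q p′ q′
SamePair-join (inj₁ (refl , refl)) s                    = s
SamePair-join (inj₂ (refl , refl)) (inj₁ (refl , refl)) = inj₂ (refl , refl)
SamePair-join (inj₂ (refl , refl)) (inj₂ (refl , refl)) = inj₁ (refl , refl)

decode-unique : ∀ {k} {c p q p′ q′ : Fin k} y → Decodes c p q y → Decodes c p′ q′ y →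
                SamePair p q p′ q′
decode-unique _ (inj₁ (_ , refl , refl)) (inj₁ (_ , refl , refl)) = inj₁ (refl , refl)
decode-unique _ (inj₁ (z≡c , _))         (inj₂ (z≢c , _))         = contradiction z≡c z≢c
decode-unique _ (inj₂ (z≢c , _))         (inj₁ (z≡c , _))         = contradiction z≡c z≢c
decode-unique _ (inj₂ (_ , s))           (inj₂ (_ , s′))          = SamePair-join s s′

module LowerBound {n k : ℕ} (2≤n : 2 ≤ n) (f : Fin n → Fin (suc k))
                  (L : IsNeighborLocating (path n) (suc k) f) where
  open IsNeighborLocating L
  open IsProperColoring isProperColoring

  one other : Fin n → Fin (suc k)
  one   u = let v , _ = pathNeighbours 2≤n u in f v
  other u = let _ , w , _ = pathNeighbours 2≤n u in f w

  nbrs : ∀ u → NbrColours f u (one u) (other u)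
  nbrs u = let v , w , u~v , u~w , only = pathNeighbours 2≤n u in record
    { one   = v , u~v , refl
    ; other = w , u~w , refl
    ; only  = λ { (x , u~x , refl) → [ inj₁ ∘ cong f , inj₂ ∘ cong f ]′ (only x u~x) }
    }

  one≢ : ∀ u → one u ≢ f u
  one≢ u eq = let v , u~v , fv≡ = NbrColours.one (nbrs u) in proper u v u~v (sym (trans fv≡ eq))

  other≢ : ∀ u → other u ≢ f u
  other≢ u eq = let v , u~v , fv≡ = NbrColours.other (nbrs u) in proper u v u~v (sym (trans fv≡ eq))

  module Code (u : Fin n) = PairCode (f u) (one u) (other u) (one≢ u) (other≢ u)

  -- Each vertex gets two triples of colours whose second entry differs from the first. `punchOut`
  -- makes this exact: with K = `suc k`, there are K³ - K² values.
  code : Fin n → Fin 2 → Fin (suc k * (k * suc k))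
  code u i = combine (f u) (combine (punchOut (Code.code-≢c u i ∘ sym)) (proj₂ (Code.code u i)))

  -- A common code yields the same colour and the same pair of neighbour colours, so locating forces
  -- u = v.
  code-injective : ∀ u i v j → code u i ≡ code v j → u ≡ v × i ≡ j
  code-injective u i v j eq
    with fu≡fv , eq′ ← combine-injective (f u) _ (f v) _ eq
    with x≡ , z≡ ← combine-injective _ (proj₂ (Code.code u i)) _ (proj₂ (Code.code v j)) eq′
    = u≡v , i≡j u≡v
    where
    codes≡ : Code.code u i ≡ Code.code v j
    codes≡ = cong₂ _,_ (punchOut-cancel fu≡fv (Code.code-≢c u i ∘ sym) (Code.code-≢c v j ∘ sym) x≡) z≡
      where
      punchOut-cancel : ∀ {c c′ x x′ : Fin (suc k)} → c ≡ c′ → (c≢x : c ≢ x) (c′≢x′ : c′ ≢ x′) →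
                        punchOut c≢x ≡ punchOut c′≢x′ → x ≡ x′
      punchOut-cancel refl c≢x c≢x′ = punchOut-injective c≢x c≢x′

    same-pair : SamePair (one u) (other u) (one v) (other v)
    same-pair = decode-unique (Code.code v j)
      (subst₂ (λ c y → Decodes c (one u) (other u) y) fu≡fv codes≡ (Code.code-decodes u i))
      (Code.code-decodes v j)

    u≡v : u ≡ v
    u≡v with u Fin.≟ v
    ... | yes u≡v = u≡v
    ... | no  u≢v = contradiction
      (samePair⇒sameImage (nbrs u) (nbrs v) same-pair)
      (locating u v u≢v fu≡fv)

    i≡j : u ≡ v → i ≡ j
    i≡j refl = Code.code-injective u i j codes≡

  n*2≤ : n * 2 ≤ suc k * (k * suc k)
  n*2≤ = injective⇒≤ {f = λ x → let u , i = remQuot 2 x in code u i} λ {x} {y} eq →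
    let u , i   = remQuot {n} 2 x
        v , j   = remQuot {n} 2 y
        u≡ , i≡ = code-injective u i v j eq
    in trans (sym (combine-remQuot {n} 2 x))
             (trans (cong₂ combine u≡ i≡) (combine-remQuot {n} 2 y))

-- Closed forms and the bound.

-- With K = `suc k`, K³ = K·k·K + K², so the truncated subtraction is exact.
bound-suc : ∀ k → bound (suc k) ≡ suc k * (k * suc k) / 2
bound-suc k = cong (_/ 2) (trans (cong (_∸ suc k ^ 2) (lemma k))
                                 (m+n∸n≡m (suc k * (k * suc k)) (suc k ^ 2)))
  where
  lemma : ∀ k → (1 + k) * ((1 + k) * ((1 + k) * 1)) ≡
                (1 + k) * (k * (1 + k)) + (1 + k) * ((1 + k) * 1)
  lemma = solve-∀

A*2 : ∀ c → A c * 2 ≡ c * (3 * c + 1)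
A*2 zero    = refl
A*2 (suc c) = begin
  (A c + (3 * c + 2)) * 2         ≡⟨ *-distribʳ-+ 2 (A c) (3 * c + 2) ⟩
  A c * 2 + (3 * c + 2) * 2       ≡⟨ cong (_+ (3 * c + 2) * 2) (A*2 c) ⟩
  c * (3 * c + 1) + (3 * c + 2) * 2 ≡⟨ lemma c ⟩
  suc c * (3 * suc c + 1)         ∎
  where
  open ≡-Reasoning
  lemma : ∀ c → c * (3 * c + 1) + (3 * c + 2) * 2 ≡ suc c * (3 * suc c + 1)
  lemma = solve-∀

B*2 : ∀ k → B (suc k) * 2 ≡ suc k * (k * suc k)
B*2 zero    = refl
B*2 (suc k) = begin
  (B (suc k) + A (suc k)) * 2                       ≡⟨ *-distribʳ-+ 2 (B (suc k)) (A (suc k)) ⟩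
  B (suc k) * 2 + A (suc k) * 2                     ≡⟨ cong₂ _+_ (B*2 k) (A*2 (suc k)) ⟩
  suc k * (k * suc k) + suc k * (3 * suc k + 1)     ≡⟨ lemma k ⟩
  suc (suc k) * (suc k * suc (suc k))               ∎
  where
  open ≡-Reasoning
  lemma : ∀ k → suc k * (k * suc k) + suc k * (3 * suc k + 1) ≡
                suc (suc k) * (suc k * suc (suc k))
  lemma = solve-∀

bound≡B : ∀ k → bound k ≡ B k
bound≡B zero    = refl
bound≡B (suc k) = trans (bound-suc k) (trans (cong (_/ 2) (sym (B*2 k))) (m*n/n≡m (B (suc k)) 2))

order≤bound : ∀ {n k} {f : Fin n → Fin k} → 2 ≤ n → IsNeighborLocating (path n) k f → n ≤ bound k
order≤bound {k = zero}  {f} 2≤n L with () ← f (fromℕ< 2≤n)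
order≤bound {n} {suc k} {f} 2≤n L = begin
  n                           ≡⟨ m*n/n≡m n 2 ⟨
  n * 2 / 2                   ≤⟨ /-monoˡ-≤ 2 (LowerBound.n*2≤ 2≤n f L) ⟩
  suc k * (k * suc k) / 2     ≡⟨ bound-suc k ⟨
  bound (suc k)               ∎
  where open ≤-Reasoning

-- Assembling the colouring.

walk-ending : ∀ {x y s x′ y′ ws} → Walk x y s x′ y′ ws → ∃[ p ] x ∷ y ∷ s ≡ p ++ x′ ∷ y′ ∷ []
walk-ending stop             = [] , refl
walk-ending (step {x = x} W) = let p , eq = walk-ending W in x ∷ p , cong (x ∷_) eq

PathColouring : ℕ → ℕ → Set
PathColouring n m = ∃[ f ] (IsNeighborLocating (path n) m f ×
  (f [v n ∸ 1 ]≡ 2) ×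
  (f [v n ]≡ 1) ×
  (9 ≤ n → f [v n ∸ 2 ]≡ m) ×
  (9 ≤ n → n ≢ bound m ∸ 1 → (f [v 1 ]≡ 2) × (f [v 2 ]≡ 1)))

-- Letter `e` becomes colour number e + 1, so the ending `1 0` of every trail gives the colours 2,
-- 1.
wordColouring : ∀ {k n a b} (W : Word (suc k) n a b) → 0 < k →
  (9 ≤ n → ∃[ p ] a ∷ b ∷ proj₁ W ≡ p ++ k ∷ 1 ∷ 0 ∷ []) →
  (9 ≤ n → n ≢ bound (suc k) ∸ 1 → a ≡ 1 × b ≡ 0) → PathColouring n (suc k)
wordColouring {k} {a = a} {b} (s , W , refl) 0<k top start =
  f , isNeighborLocating ,
  (let p , eq = walk-ending walk in fromEnd p eq zeroth) ,
  (let p , eq = walk-ending walk in fromEnd p eq (later zeroth)) ,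
  (λ 9≤n → let p , eq = top 9≤n in fromEnd p eq zeroth) ,
  (λ 9≤n n≢ → let a≡1 , b≡0 = start 9≤n n≢ in
    coloured zeroth refl (cong suc a≡1) , coloured (later zeroth) refl (cong suc b≡0))
  where
  open Colouring (s<s 0<k) W
  open Trail W

  coloured : ∀ {i e j c} → word at i is e → suc i ≡ j → suc e ≡ c → f [v j ]≡ c
  coloured at-e refl refl =
    let u , u≡i , fu≡e = at⇒vertex at-e in u , cong suc u≡i , cong suc fu≡e

  -- For an explicit suffix `e` the offset `length e ∸ suc i` evaluates; its three uses give the
  -- required offsets 1, 0 and 2.
  fromEnd : ∀ p {e} {i c} → word ≡ p ++ e → e at i is c →
            f [v length word ∸ (length e ∸ suc i) ]≡ suc c
  fromEnd p {e} {i} eq at-c =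
    coloured (subst (_at length p + i is _) (sym eq) (at-++ p at-c)) position refl
    where
    at⇒< : ∀ {xs : List ℕ} {i x} → xs at i is x → suc i ≤ length xs
    at⇒< zeroth    = s≤s z≤n
    at⇒< (later q) = s≤s (at⇒< q)
    open ≡-Reasoning
    position : suc (length p + i) ≡ length word ∸ (length e ∸ suc i)
    position = begin
      suc (length p + i)
        ≡⟨ +-suc (length p) i ⟨
      length p + suc i
        ≡⟨ cong (length p +_) (m∸[m∸n]≡n (at⇒< at-c)) ⟨
      length p + (length e ∸ (length e ∸ suc i))
        ≡⟨ +-∸-assoc (length p) (m∸n≤m (length e) (suc i)) ⟨
      length p + length e ∸ (length e ∸ suc i)
        ≡⟨ cong (_∸ (length e ∸ suc i)) (trans (cong length eq) (length-++ p)) ⟨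
      length word ∸ (length e ∸ suc i) ∎

shortColouring : ∀ {k n a b} → Word (suc k) n a b → 0 < k → n < 9 → PathColouring n (suc k)
shortColouring W 0<k n<9 = wordColouring W 0<k
  (λ 9≤n → contradiction 9≤n (<⇒≱ n<9)) (λ 9≤n → contradiction 9≤n (<⇒≱ n<9))

topColouring : ∀ {k n} → TopWord k n 1 0 → 0 < k → PathColouring n (suc k)
topColouring (s , W , eq , top) 0<k = wordColouring (s , W , eq) 0<k (λ _ → top) (λ _ _ → refl , refl)

-- Below 9 only the ending `1 0` is required. The lengths 5 = 9 - 4, 7 = 9 - 2 and 9 come from the
-- core tails.
colouring₃ : ∀ n → 2 < n → n ≤ 9 → PathColouring n 3
colouring₃ 0 () _
colouring₃ 1 (s≤s ()) _
colouring₃ 2 (s≤s (s≤s ())) _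
colouring₃ 3 _ _ = shortColouring word₃ z<s (m≤m+n 4 5)
colouring₃ 4 _ _ = shortColouring word₄ z<s (m≤m+n 5 4)
colouring₃ 5 _ _ =
  let n , W , eq = nearlyFullWord 0 (suc (suc zero))
  in topColouring (subst (λ n → TopWord 2 n 1 0) (+-cancelˡ-≡ 4 n 5 eq) W) z<s
colouring₃ 6 _ _ = shortColouring word₆ z<s (m≤m+n 7 2)
colouring₃ 7 _ _ =
  let n , W , eq = nearlyFullWord 0 (suc zero)
  in topColouring (subst (λ n → TopWord 2 n 1 0) (+-cancelˡ-≡ 2 n 7 eq) W) z<s
colouring₃ 8 _ _ = shortColouring word₈ z<s (m≤m+n 9 0)
colouring₃ 9 _ _ =
  let n , W , eq = nearlyFullWord 0 zero
  in topColouring (subst (λ n → TopWord 2 n 1 0) eq W) z<s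
colouring₃ (suc (suc (suc (suc (suc (suc (suc (suc (suc (suc n)))))))))) _ 10+n≤9 =
  contradiction (+-cancelˡ-≤ 9 (suc n) 0 10+n≤9) λ ()

colouring₄₊ : ∀ j n → B (3 + j) < n → n ≤ B (4 + j) → PathColouring n (4 + j)
colouring₄₊ j n lo hi with suc n ≟ B (4 + j)
... | yes n+1≡B =
  let n′ , (s , W , eq , top) , eq′ = almostTop j
  in wordColouring (s , W , trans eq (suc-injective (trans eq′ (sym n+1≡B)))) z<s (λ _ → top)
       -- This is the exceptional length, so nothing is claimed about the first two vertices.
       (λ _ n≢ → contradiction (cong (_∸ 1) (trans n+1≡B (sym (bound≡B (4 + j))))) n≢)
... | no n+1≢B with L , refl ← m≤n⇒∃[o]m+o≡n (<⇒≤ lo) =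
  topColouring (wordOfLength j L
    (+-cancelˡ-< (B (3 + j)) 0 L (subst (_< B (3 + j) + L) (sym (+-identityʳ _)) lo))
    (+-cancelˡ-≤ (B (3 + j)) L (A (3 + j)) hi)
    (λ eq → n+1≢B (trans (sym (+-suc _ L)) (cong (B (3 + j) +_) eq)))) z<s

pathColouring : ∀ m n → 2 ≤ n → B (pred m) < n → n ≤ B m → PathColouring n m
-- `B 0` and `B 1` are both 0.
pathColouring 0 n 2≤n lo hi = contradiction (≤-trans lo hi) λ ()
pathColouring 1 n 2≤n lo hi = contradiction (≤-trans lo hi) λ ()
pathColouring 2 n 2≤n lo hi with refl ← ≤-antisym hi 2≤n = shortColouring word₂ z<s (m≤m+n 3 6)
pathColouring 3 n _   lo hi = colouring₃ n lo hi
pathColouring (suc (suc (suc (suc j)))) n _ lo hi = colouring₄₊ j n lo hi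

theorem2 : (n m : ℕ) → 2 ≤ n → IsLeast (λ k → n ≤ bound k) m →
    (χL₂[ path n ]≡ m) ×
    (∃[ f ] (IsNeighborLocating (path n) m f ×
    (f [v n ∸ 1 ]≡ 2) ×
    (f [v n ]≡ 1) ×
    (9 ≤ n → f [v n ∸ 2 ]≡ m) ×
    (9 ≤ n → n ≢ bound m ∸ 1 → (f [v 1 ]≡ 2) × (f [v 2 ]≡ 1))))
theorem2 n m 2≤n (n≤bound , least) =
  ((proj₁ g , proj₁ (proj₂ g)) , λ j (_ , L) → least j (order≤bound 2≤n L)) , g
  where
  -- By minimality, m - 1 colours are too few, so `n` lies between consecutive values of `B`.
  above : ∀ m → n ≤ bound m → (∀ j → n ≤ bound j → m ≤ j) → B (pred m) < n
  above zero    n≤0 _ = contradiction (≤-trans 2≤n n≤0) λ ()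
  above (suc m) _ least = ≰⇒> λ n≤B → 1+n≰n (least m (subst (n ≤_) (sym (bound≡B m)) n≤B))

  g : PathColouring n m
  g = pathColouring m n 2≤n (above m n≤bound least) (subst (n ≤_) (bound≡B m) n≤bound)
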